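{- Let $d$ be any non-negative integer constant and let $\Delta = 2d+1$. Then there is a deterministic distributed algorithm in the LOCAL model that runs in $5\Delta^3$ rounds and that finds a maximal fractional matching in every graph of maximum degree at most $\Delta$, using only edge values of the form $a/b$ with $a \in \{0,1,\dotsc,2^d\}$ and $b = 2^d$.
   Context: Fractional matching: for a finite simple graph $G=(V,E)$ and $x\colon E\to[0,1]$, write $x[v]=\sum_{e\in E: v\in e} x(e)$ for $v \in V$. The function $x$ is a fractional matching if $x[v]\le 1$ for all $v\in V$; it is a maximal fractional matching if in addition for every edge $\{u,v\}\in E$ at least one endpoint is saturated, i.e. $x[u]=1$ or $x[v]=1$. PN (port-numbering) model: each node of the input graph $G$ is a computer and each edge is a communication link. An adversary chooses a port numbering: each node $v$ of degree $\deg(v)$ refers to its incident edges by the numbers $1,\dotsc,\deg(v)$. Initially each node knows only its degree (and the global constant $\Delta$), and nodes of the same degree start in the same state. Computation is deterministic and proceeds in synchronous rounds; in each round each node sends a message (of arbitrary size) through each port, receives a message from each port, and updates its state by arbitrary local computation as a function of its current state and the received messages. A node may stop after any number of rounds and announce its local output, here the value $x(e)$ of each incident edge $e$ (the two endpoints of an edge must announce the same value). The running time is the number of rounds until all nodes have stopped. An algorithm must be correct for every input graph in the family and every port numbering. LOCAL model: the same as the PN model, except that each node is additionally given as input a unique identifier, chosen by an adversary from a set of size polynomial in $n=|V|$, e.g. $\{1,\dotsc,n^c\}$ for a fixed constant $c \ge 1$. An algorithm must be correct for every choice of unique identifiers. -}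

module Defs where

open import Data.Fin using (Fin)
open import Data.Integer using (+_)
open import Data.List using (List; allFin; filter; foldr; length; map)
open import Data.Maybe using (Maybe; just; nothing)
open import Data.Nat as ℕ using (ℕ; zero; suc; NonZero)
open import Data.Product using (_×_; _,_; ∃-syntax)
open import Data.Rational using (ℚ; 0ℚ; 1ℚ; _+_; _≤_; _/_)
open import Data.Sum using (_⊎_)
open import Function using (Injective)
open import Level using (0ℓ)
open import Relation.Binary using (Rel; Decidable; Symmetric; Irreflexive)
open import Relation.Binary.PropositionalEquality using (_≡_)

record Graph (n : ℕ) : Set₁ where
  infix 4 _~_ _~?_
  field
    _~_      : Rel (Fin n) 0ℓ
    _~?_     : Decidable _~_
    ~-sym    : Symmetric _~_
    ~-irrefl : Irreflexive _≡_ _~_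

  neighbours : Fin n → List (Fin n)
  neighbours v = filter (v ~?_) (allFin n)

  deg : Fin n → ℕ
  deg v = length (neighbours v)

  MaxDegree≤ : ℕ → Set
  MaxDegree≤ Δ = ∀ v → deg v ℕ.≤ Δ

module _ {n : ℕ} (G : Graph n) where
  open Graph G

  -- A function on the edges {u , v}, given by its values x u v at ordered
  -- pairs.  The values at non-adjacent pairs are irrelevant: nothing below
  -- refers to them.
  IsEdgeFunction : (Fin n → Fin n → ℚ) → Set
  IsEdgeFunction x = ∀ {u v} → u ~ v → x u v ≡ x v u

  -- Written x[v] in mathematical notation.
  load : (Fin n → Fin n → ℚ) → Fin n → ℚ
  load x v = foldr _+_ 0ℚ (map (x v) (neighbours v))

  record IsFractionalMatching (x : Fin n → Fin n → ℚ) : Set where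
    field
      isEdgeFunction : IsEdgeFunction x
      nonNegative    : ∀ {u v} → u ~ v → 0ℚ ≤ x u v
      atMostOne      : ∀ {u v} → u ~ v → x u v ≤ 1ℚ
      load≤1         : ∀ v → load x v ≤ 1ℚ

  record IsMaximalFractionalMatching (x : Fin n → Fin n → ℚ) : Set where
    field
      isFractionalMatching : IsFractionalMatching x
      saturated : ∀ {u v} → u ~ v → load x u ≡ 1ℚ ⊎ load x v ≡ 1ℚ

  HasEdgeValuesOver : (b : ℕ) .{{_ : NonZero b}} → (Fin n → Fin n → ℚ) → Set
  HasEdgeValuesOver b x =
    ∀ {u v} → u ~ v → ∃[ a ] (a ℕ.≤ b × x u v ≡ (+ a) / b)

  -- For each node v, a bijection between the ports Fin (deg v) (numbered from
  -- zero) and the neighbours of v.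
  record PortNumbering : Set where
    field
      nbr      : ∀ v → Fin (deg v) → Fin n
      nbr-~    : ∀ v p → v ~ nbr v p
      nbr-inj  : ∀ v → Injective _≡_ _≡_ (nbr v)
      port     : ∀ {v u} → v ~ u → Fin (deg v)
      nbr-port : ∀ {v u} (e : v ~ u) → nbr v (port e) ≡ u

    -- The port at the other end of the edge behind port p of v.
    backPort : ∀ v p → Fin (deg (nbr v p))
    backPort v p = port (~-sym (nbr-~ v p))

-- A deterministic synchronous algorithm for port-numbered networks in which
-- each node has a local input and outputs one rational number per port.  The
-- index k is the degree of the node.  Nodes know nothing else about the graph;
-- a global constant is known to them if the algorithm may be chosen depending
-- on it.  A node has stopped when its state has an output.
record Algorithm (Input : Set) : Set₁ where
  field
    State   : ℕ → Set
    Message : Set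
    init    : ∀ {k} → Input → State k
    send    : ∀ {k} → State k → Fin k → Message
    receive : ∀ {k} → State k → (Fin k → Message) → State k
    output  : ∀ {k} → State k → Maybe (Fin k → ℚ)

  -- A stopped node never changes its state, hence not its output either; its
  -- neighbours keep receiving the messages determined by its final state.
  update : ∀ {k} → State k → (Fin k → Message) → State k
  update s m with output s
  ... | just _  = s
  ... | nothing = receive s m

module Execution {Input : Set} (A : Algorithm Input)
                 {n : ℕ} (G : Graph n) (P : PortNumbering G)
                 (input : Fin n → Input) where
  open Algorithm A
  open Graph G
  open PortNumbering P

  state : ℕ → ∀ v → State (deg v)
  state zero    v = init (input v)
  state (suc t) v =
    update (state t v) λ p → send (state t (nbr v p)) (backPort v p)

  -- Within T rounds all nodes have stopped, and each node has announced the
  -- value of x at each incident edge.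
  OutputsWithin : ℕ → (Fin n → Fin n → ℚ) → Set
  OutputsWithin T x =
    ∀ v → ∃[ o ] (output (state T v) ≡ just o × ∀ p → o p ≡ x v (nbr v p))

open Execution public using (OutputsWithin)

-- In the LOCAL model, the local input of a node is its unique identifier.
LocalAlgorithm : Set₁
LocalAlgorithm = Algorithm ℕ

-- The adversary chooses the identifiers from {1, …, n ^ c}; the constant c is a
-- parameter of the LOCAL model.
record Identifiers (c n : ℕ) : Set where
  field
    id     : Fin n → ℕ
    id-inj : Injective _≡_ _≡_ id
    1≤id   : ∀ v → 1 ℕ.≤ id v
    id≤n^c : ∀ v → id v ℕ.≤ n ℕ.^ c

{-# OPTIONS --safe #-}
module Submission where

-- Measure edge values in units of 2 ^ -d.  In phase k = d , … , 0 both endpoints of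
-- every unsaturated edge are live, and a live node has residual capacity 2 ^ k and
-- at most 2 k + 1 live neighbours.  A phase lowers this degree bound twice.
--
-- First to 2 k.  Label every edge by its two port numbers and orient it from the
-- smaller to the larger identifier: each label class consists of directed paths.
-- If the degree of v is odd then its in-degree and out-degree differ, so v is an
-- end of some such path.  Going through all labels and both orientations, match
-- each first node of a path to the second one, saturating both; then every node
-- of odd degree is saturated or loses a neighbour.
--
-- Then to 2 k - 1, at the price of halving the capacity.  Take a maximal matching
-- of the bipartite double cover, one label class at a time, each matched edge
-- getting the value 2 ^ (k - 1).  An edge that remains unsaturated joins two nodes
-- with exactly one copy matched, of the same colour.  The partner of this copy has
-- its copy of that colour matched too, as the matching is maximal, so it is
-- saturated.  A node with no matched copy has only saturated neighbours.

open import Defs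
import Algebra.Properties.CommutativeSemigroup
import Algebra.Properties.Semiring.Sum
open import Data.Bool using (Bool; true; false; T; not; _∧_; _∨_; _xor_)
open import Data.Bool.Properties using (T-∧; T?; ∧-identityʳ)
open import Data.Fin using (Fin; zero; suc; toℕ)
open import Data.Fin.Properties using (any?; toℕ-injective; toℕ<n; 0≢1+n; suc-injective)
open import Data.Integer as ℤ using () renaming (+_ to pos)
import Data.Integer.Properties as ℤ
open import Data.List using (List; []; _∷_; _++_; length; map; upTo; cartesianProduct; filter; foldr; tabulate)
open import Data.List.Membership.Propositional using (_∈_)
open import Data.List.Membership.Propositional.Properties using (∈-cartesianProduct⁺; ∈-upTo⁺)
open import Data.List.Properties using (length-++; length-map; length-upTo)
open import Data.List.Relation.Unary.Any using (here; there)
open import Data.Maybe using (Maybe; just; nothing)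
open import Data.Nat as ℕ using (ℕ; zero; suc; _+_; _*_; _^_; _≤_; _<_; z≤n; s≤s; _≟_; _<ᵇ_; NonZero)
open import Data.Nat.Properties hiding (0≢1+n; suc-injective)
open import Data.Nat.Solver using (module +-*-Solver)
open import Data.Product using (_×_; _,_; Σ-syntax; ∃-syntax; ∃; proj₁; proj₂)
open import Data.Rational as ℚ using (ℚ; 0ℚ; 1ℚ; _/_; toℚᵘ)
import Data.Rational.Properties as ℚ
open import Data.Rational.Unnormalised as ℚᵘ using (mkℚᵘ; *≡*)
import Data.Rational.Unnormalised.Properties as ℚᵘ
open import Data.Sum using (_⊎_; inj₁; inj₂) renaming (map to map-⊎)
open import Function using (_∘_; id; mk⇔; Injective; Equivalence)
open import Level using (0ℓ)
open import Relation.Binary using (tri<; tri≈; tri>)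
open import Relation.Binary.PropositionalEquality using (_≡_; refl; sym; trans; cong; cong₂; subst; subst₂; module ≡-Reasoning)
open import Relation.Nullary using (¬_; Dec; yes; no; does; contradiction; _×-dec_; _⊎-dec_; ¬?)
open import Relation.Nullary.Decidable using (does-⇔; dec-true; dec-false; decidable-stable; map′)
open import Relation.Unary using (Decidable; Pred)

open Algebra.Properties.Semiring.Sum +-*-semiring
  using (sum; ∑-comm; ∑-distrib-+; sum-cong-≗; *-distribˡ-sum)
open Algebra.Properties.CommutativeSemigroup +-commutativeSemigroup using (interchange)
open Equivalence using (to; from)

-- Counting by sums over Fin n

𝟙 : Bool → ℕ
𝟙 true  = 1
𝟙 false = 0

count : ∀ {n} {P : Pred (Fin n) 0ℓ} → Decidable P → ℕ
count P? = sum (λ u → 𝟙 (does (P? u)))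

sum-zero : ∀ {n} {f : Fin n → ℕ} → (∀ u → f u ≡ 0) → sum f ≡ 0
sum-zero {zero}  f≡0 = refl
sum-zero {suc n} f≡0 = cong₂ _+_ (f≡0 zero) (sum-zero (f≡0 ∘ suc))

sum-mono-≤ : ∀ {n} {f g : Fin n → ℕ} → (∀ u → f u ≤ g u) → sum f ≤ sum g
sum-mono-≤ {zero}  f≤g = z≤n
sum-mono-≤ {suc n} f≤g = +-mono-≤ (f≤g zero) (sum-mono-≤ (f≤g ∘ suc))

sum-mono-< : ∀ {n} {f g : Fin n → ℕ} → (∀ u → f u ≤ g u) → ∀ u → f u < g u → sum f < sum g
sum-mono-< f≤g zero    fu<gu = +-mono-<-≤ fu<gu (sum-mono-≤ (f≤g ∘ suc))
sum-mono-< f≤g (suc u) fu<gu = +-mono-≤-< (f≤g zero) (sum-mono-< (f≤g ∘ suc) u fu<gu)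

term≤sum : ∀ {n} (f : Fin n → ℕ) u → f u ≤ sum f
term≤sum f zero    = m≤m+n _ _
term≤sum f (suc u) = ≤-trans (term≤sum (f ∘ suc) u) (m≤n+m _ _)

𝟙-mono : ∀ {P Q : Set} (P? : Dec P) (Q? : Dec Q) → (P → Q) → 𝟙 (does P?) ≤ 𝟙 (does Q?)
𝟙-mono (no  _) _       _   = z≤n
𝟙-mono (yes p) (yes _) _   = ≤-refl
𝟙-mono (yes p) (no ¬q) p⇒q = contradiction (p⇒q p) ¬q

𝟙-cong : ∀ {P Q : Set} (P? : Dec P) (Q? : Dec Q) → (P → Q) → (Q → P) → 𝟙 (does P?) ≡ 𝟙 (does Q?)
𝟙-cong P? Q? f g = cong 𝟙 (does-⇔ (mk⇔ f g) P? Q?)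

module _ {n} {P Q : Pred (Fin n) 0ℓ} (P? : Decidable P) (Q? : Decidable Q) where

  count-mono : (∀ {u} → P u → Q u) → count P? ≤ count Q?
  count-mono P⊆Q = sum-mono-≤ λ u → 𝟙-mono (P? u) (Q? u) P⊆Q

  count-mono-< : (∀ {u} → P u → Q u) → ∀ {u} → Q u → ¬ P u → count P? < count Q?
  count-mono-< P⊆Q {u} q ¬p = sum-mono-< (λ u → 𝟙-mono (P? u) (Q? u) P⊆Q) u
    (subst₂ _<_ (sym (cong 𝟙 (dec-false (P? u) ¬p))) (sym (cong 𝟙 (dec-true (Q? u) q))) (s≤s z≤n))

count-unique : ∀ {n} {P : Pred (Fin n) 0ℓ} (P? : Decidable P) →
               (∀ {u w} → P u → P w → u ≡ w) → count P? ≡ 𝟙 (does (any? P?))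
count-unique {zero}  P? unique = refl
count-unique {suc n} P? unique with P? zero
... | yes p = cong suc (sum-zero λ u → cong 𝟙 (dec-false (P? (suc u)) λ q → 0≢1+n (unique p q)))
... | no  _ = count-unique (P? ∘ suc) λ p q → suc-injective (unique p q)

-- Double counting of the pairs (`u` , `w`): each `u` in `P` has exactly one partner, and so has
-- each `w` in `Q`. A relation replaces a function because partners are only known to exist.
count-bijection :
  ∀ {n} {P Q : Pred (Fin n) 0ℓ} (P? : Decidable P) (Q? : Decidable Q)
  {R : Fin n → Fin n → Set} (R? : ∀ u w → Dec (R u w)) →
  (∀ {u} → P u → ∃[ w ] (Q w × R u w)) →
  (∀ {w} → Q w → ∃[ u ] (P u × R u w)) →
  (∀ {u w w′} → Q w → Q w′ → R u w → R u w′ → w ≡ w′) →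
  (∀ {u u′ w} → P u → P u′ → R u w → R u′ w → u ≡ u′) →
  count P? ≡ count Q?
count-bijection {P = P} {Q} P? Q? {R} R? to from functional injective = begin
  count P?                                              ≡⟨ sum-cong-≗ rows ⟩
  sum (λ u → sum (λ w → 𝟙 (does (pair? u w))))          ≡⟨ ∑-comm (λ u w → 𝟙 (does (pair? u w))) ⟩
  sum (λ w → sum (λ u → 𝟙 (does (pair? u w))))          ≡⟨ sum-cong-≗ columns ⟨
  count Q?                                              ∎
  where
  open ≡-Reasoning
  pair? : ∀ u w → Dec (P u × Q w × R u w)
  pair? u w = P? u ×-dec Q? w ×-dec R? u w
  rows : ∀ u → 𝟙 (does (P? u)) ≡ count (pair? u)
  rows u = trans
    (𝟙-cong (P? u) (any? (pair? u)) (λ p → let w , q , r = to p in w , p , q , r) (proj₁ ∘ proj₂))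
    (sym (count-unique (pair? u) λ (_ , q , r) (_ , q′ , r′) → functional q q′ r r′))
  columns : ∀ w → 𝟙 (does (Q? w)) ≡ count (λ u → pair? u w)
  columns w = trans
    (𝟙-cong (Q? w) (any? λ u → pair? u w) (λ q → let u , p , r = from q in u , p , q , r) (proj₁ ∘ proj₂ ∘ proj₂))
    (sym (count-unique (λ u → pair? u w) λ (p , _ , r) (p′ , _ , r′) → injective p p′ r r′))

-- Algorithms given by a list of rounds

-- A node is live while it takes part in the algorithm; white and black tell which
-- of its two copies in the bipartite double cover are still unmatched.
record Status : Set where
  field
    mark live white black : Bool

-- In a round, v sends weight units to u if the edge has port number outPort at v
-- and inPort at u, and the rule holds for the identifiers and the statuses of v
-- and u.  So a node sends at most once and receives at most once, and its next
-- status depends on whether it sends and whether it receives.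
record Round : Set where
  field
    outPort inPort : ℕ
    weight         : ℕ
    rule           : ℕ → Status → ℕ → Status → Bool
    next           : Bool → Bool → Status → Status

-- The message `m a` carries the far port number, identifier and status. Hence both ends of an edge
-- can evaluate `rule` in both directions and agree on what is transferred.
module Local (r : Round) {k} (i : ℕ) (s : Status) (m : Fin k → ℕ × ℕ × Status) where
  open Round r

  Sends Receives : Fin k → Set
  Sends    a = let b , j , t = m a in toℕ a ≡ outPort × b ≡ inPort × T (rule i s j t)
  Receives a = let b , j , t = m a in b ≡ outPort × toℕ a ≡ inPort × T (rule j t i s)

  sends? : ∀ a → Dec (Sends a)
  sends? a = let b , j , t = m a in toℕ a ≟ outPort ×-dec b ≟ inPort ×-dec T? (rule i s j t)

  receives? : ∀ a → Dec (Receives a)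
  receives? a = let b , j , t = m a in b ≟ outPort ×-dec toℕ a ≟ inPort ×-dec T? (rule j t i s)

record NodeState (k : ℕ) : Set where
  constructor node
  field
    schedule : List Round
    ident    : ℕ
    status   : Status
    value    : Fin k → ℕ

perform : ∀ {k} → Round → List Round → NodeState k → (Fin k → ℕ × ℕ × Status) → NodeState k
perform r rs (node _ i s x) m = node rs i
  (next (does (any? sends?)) (does (any? receives?)) s)
  (λ a → x a + weight * (𝟙 (does (sends? a)) + 𝟙 (does (receives? a))))
  where
  open Round r
  open Local r i s m

scheduled : List Round → Status → (ℕ → ℚ) → LocalAlgorithm
scheduled rs s₀ f = record
  { State   = NodeState
  ; Message = ℕ × ℕ × Status
  ; init    = λ i → node rs i s₀ λ _ → 0
  ; send    = λ (node _ i s _) a → toℕ a , i , s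
  ; receive = receive
  ; output  = output
  }
  where
  receive : ∀ {k} → NodeState k → (Fin k → ℕ × ℕ × Status) → NodeState k
  receive s@(node []       _ _ _) m = s
  receive s@(node (r ∷ rs) _ _ _) m = perform r rs s m

  output : ∀ {k} → NodeState k → Maybe (Fin k → ℚ)
  output (node []      _ _ x) = just (f ∘ x)
  output (node (_ ∷ _) _ _ _) = nothing

-- Executions of stopped algorithms

module _ {Input : Set} (A : Algorithm Input) where
  open Algorithm A

  update-stopped : ∀ {k} {s : State k} {m o} → output s ≡ just o → update s m ≡ s
  update-stopped {s = s} eq with just _ ← output s = refl

  module _ {n} (G : Graph n) (P : PortNumbering G) (input : Fin n → Input) where
    open Execution A G P input using (state)

    outputsWithin-+ : ∀ j {t} x → OutputsWithin A G P input t x → OutputsWithin A G P input (j + t) x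
    outputsWithin-+ zero    x out v = out v
    outputsWithin-+ (suc j) x out v with o , eq , o≗x ← outputsWithin-+ j x out v =
      o , trans (cong output (update-stopped eq)) eq , o≗x

    -- A schedule may be shorter than the promised time, while `OutputsWithin` inspects the state at
    -- one time only; a stopped node keeps its state.
    outputsWithin-≤ : ∀ {t t′} x → t ≤ t′ → OutputsWithin A G P input t x → OutputsWithin A G P input t′ x
    outputsWithin-≤ {t} x t≤t′ out with j , eq ← m≤n⇒∃[o]m+o≡n t≤t′ =
      subst (λ t′ → OutputsWithin A G P input t′ x) (trans (+-comm j t) eq) (outputsWithin-+ j x out)

-- The global view of a scheduled execution

module Network {n} (G : Graph n) (P : PortNumbering G) (ident : Fin n → ℕ) where
  open Graph G
  open PortNumbering P

  port-irrelevant : ∀ {v u} (e e′ : v ~ u) → port e ≡ port e′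
  port-irrelevant e e′ = nbr-inj _ (trans (nbr-port e) (sym (nbr-port e′)))

  -- The port number at v of the edge {v , u}, and 0 if there is no such edge.
  endPort : Fin n → Fin n → ℕ
  endPort v u with v ~? u
  ... | yes e = toℕ (port e)
  ... | no  _ = 0

  endPort-~ : ∀ {v u} (e : v ~ u) → endPort v u ≡ toℕ (port e)
  endPort-~ {v} {u} e with v ~? u
  ... | yes e′ = cong toℕ (port-irrelevant e′ e)
  ... | no ¬e  = contradiction e ¬e

  endPort-injective : ∀ {v u u′} → v ~ u → v ~ u′ → endPort v u ≡ endPort v u′ → u ≡ u′
  endPort-injective e e′ eq = trans (sym (nbr-port e)) (trans (cong (nbr _) same-port) (nbr-port e′))
    where
    same-port : port e ≡ port e′
    same-port = toℕ-injective (trans (sym (endPort-~ e)) (trans eq (endPort-~ e′)))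

  Label : ℕ → ℕ → Fin n → Fin n → Set
  Label p q v u = v ~ u × endPort v u ≡ p × endPort u v ≡ q

  label? : ∀ p q v u → Dec (Label p q v u)
  label? p q v u = v ~? u ×-dec endPort v u ≟ p ×-dec endPort u v ≟ q

  label-sym : ∀ {p q v u} → Label p q v u → Label q p u v
  label-sym (e , a , b) = ~-sym e , b , a

  -- The port number at `v` alone fixes the edge. So a label class has at most one edge out of `v`
  -- and, by `label-sym`, at most one into `v`: it consists of directed paths and cycles, and
  -- orienting by identifiers excludes the cycles.
  label-functional : ∀ {p q q′ v u u′} → Label p q v u → Label p q′ v u′ → u ≡ u′
  label-functional (e , a , _) (e′ , a′ , _) = endPort-injective e e′ (trans a (sym a′))

  record Config : Set where
    field
      status : Fin n → Status
      value  : Fin n → Fin n → ℕ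
  open Config public

  module _ (r : Round) (c : Config) where
    open Round r

    Transfer : Fin n → Fin n → Set
    Transfer v u = Label outPort inPort v u × T (rule (ident v) (status c v) (ident u) (status c u))

    transfer? : ∀ v u → Dec (Transfer v u)
    transfer? v u = label? outPort inPort v u ×-dec T? (rule (ident v) (status c v) (ident u) (status c u))

    sends? : ∀ v → Dec (∃[ u ] Transfer v u)
    sends? v = any? (transfer? v)

    receives? : ∀ v → Dec (∃[ u ] Transfer u v)
    receives? v = any? λ u → transfer? u v

    exec : Config
    status exec v   = next (does (sends? v)) (does (receives? v)) (status c v)
    value  exec v u = value c v u + weight * (𝟙 (does (transfer? v u)) + 𝟙 (does (transfer? u v)))

  run : List Round → Config → Config
  run []       c = c
  run (r ∷ rs) c = run rs (exec r c)

  run-++ : ∀ rs {rs′ c} → run (rs ++ rs′) c ≡ run rs′ (run rs c)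
  run-++ []       = refl
  run-++ (r ∷ rs) = run-++ rs

  start : Status → Config
  status (start s₀) _   = s₀
  value  (start s₀) _ _ = 0

  module _ (rs₀ : List Round) (s₀ : Status) (f : ℕ → ℚ) where
    open Algorithm (scheduled rs₀ s₀ f) using (send; update)
    open Execution (scheduled rs₀ s₀ f) G P ident using (state)

    -- The simulation invariant: `Config` indexes edge values by pairs of nodes, a node knows them
    -- by port.
    record Agrees (rs : List Round) (c : Config) (v : Fin n) (s : NodeState (deg v)) : Set where
      field
        schedule≡ : NodeState.schedule s ≡ rs
        ident≡    : NodeState.ident s ≡ ident v
        status≡   : NodeState.status s ≡ status c v
        value≡    : ∀ a → NodeState.value s a ≡ value c v (nbr v a)
    open Agrees

    -- A transfer needs adjacency, so its partner is behind some port, and the tests over the ports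
    -- of `v` have the same outcomes as the tests over all nodes in `exec`.
    agrees-step : ∀ {r rs c} {s : ∀ v → NodeState (deg v)} → (∀ v → Agrees (r ∷ rs) c v (s v)) →
                  ∀ v → Agrees rs (exec r c) v (update (s v) λ a → send (s (nbr v a)) (backPort v a))
    agrees-step {r} {rs} {c} {s} ag v = record
      { schedule≡ = cong NodeState.schedule eq
      ; ident≡    = trans (cong NodeState.ident eq) (ident≡ (ag v))
      ; status≡   = trans (cong NodeState.status eq)
          (trans (cong₂ (λ a b → next a b (NodeState.status (s v)))
                   (does-⇔ (mk⇔ (λ (a , x) → nbr v a , sends⇒ x) sends⇐) (any? L.sends?) (sends? r c v))
                   (does-⇔ (mk⇔ (λ (a , x) → nbr v a , receives⇒ x) receives⇐) (any? L.receives?) (receives? r c v)))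
                 (cong (next _ _) (status≡ (ag v))))
      ; value≡    = λ a → trans (cong (λ s → NodeState.value s a) eq)
          (cong₂ (λ x y → x + weight * y) (value≡ (ag v) a)
            (cong₂ _+_ (𝟙-cong (L.sends? a) (transfer? r c v (nbr v a)) sends⇒ (sends⇐′ a))
                       (𝟙-cong (L.receives? a) (transfer? r c (nbr v a) v) receives⇒ (receives⇐′ a))))
      }
      where
      open Round r
      m : Fin (deg v) → ℕ × ℕ × Status
      m a = send (s (nbr v a)) (backPort v a)
      module L = Local r (NodeState.ident (s v)) (NodeState.status (s v)) m

      -- A nonempty schedule gives no output, so `update` does call `receive`.
      eq : update (s v) m ≡ perform r rs (s v) m
      eq with s v | schedule≡ (ag v)
      ... | node _ _ _ _ | refl = refl

      out-rule : ∀ a → rule (NodeState.ident (s v)) (NodeState.status (s v)) (NodeState.ident (s (nbr v a))) (NodeState.status (s (nbr v a)))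
             ≡ rule (ident v) (status c v) (ident (nbr v a)) (status c (nbr v a))
      out-rule a rewrite ident≡ (ag v) | status≡ (ag v) | ident≡ (ag (nbr v a)) | status≡ (ag (nbr v a)) = refl

      in-rule : ∀ a → rule (NodeState.ident (s (nbr v a))) (NodeState.status (s (nbr v a))) (NodeState.ident (s v)) (NodeState.status (s v))
             ≡ rule (ident (nbr v a)) (status c (nbr v a)) (ident v) (status c v)
      in-rule a rewrite ident≡ (ag v) | status≡ (ag v) | ident≡ (ag (nbr v a)) | status≡ (ag (nbr v a)) = refl

      own-port : ∀ a → port (nbr-~ v a) ≡ a
      own-port a = nbr-inj v (nbr-port (nbr-~ v a))

      endPort-near : ∀ a → endPort v (nbr v a) ≡ toℕ a
      endPort-near a = trans (endPort-~ (nbr-~ v a)) (cong toℕ (own-port a))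

      endPort-far : ∀ a → endPort (nbr v a) v ≡ toℕ (backPort v a)
      endPort-far a = endPort-~ (~-sym (nbr-~ v a))

      local-label : ∀ {p q} a → toℕ a ≡ p → toℕ (backPort v a) ≡ q → Label p q v (nbr v a)
      local-label a x y = nbr-~ v a , trans (endPort-near a) x , trans (endPort-far a) y

      label-local : ∀ {p q} a → Label p q v (nbr v a) → toℕ a ≡ p × toℕ (backPort v a) ≡ q
      label-local a (_ , x , y) = trans (sym (endPort-near a)) x , trans (sym (endPort-far a)) y

      sends⇒ : ∀ {a} → L.Sends a → Transfer r c v (nbr v a)
      sends⇒ {a} (x , y , z) = local-label a x y , subst T (out-rule a) z

      sends⇐′ : ∀ a → Transfer r c v (nbr v a) → L.Sends a
      sends⇐′ a (l , z) = let x , y = label-local a l in x , y , subst T (sym (out-rule a)) z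

      sends⇐ : ∃ (Transfer r c v) → ∃ L.Sends
      sends⇐ (u , x@((e , _) , _)) = port e , sends⇐′ (port e) (subst (Transfer r c v) (sym (nbr-port e)) x)

      receives⇒ : ∀ {a} → L.Receives a → Transfer r c (nbr v a) v
      receives⇒ {a} (x , y , z) = label-sym (local-label a y x) , subst T (in-rule a) z

      receives⇐′ : ∀ a → Transfer r c (nbr v a) v → L.Receives a
      receives⇐′ a (l , z) = let y , x = label-local a (label-sym l) in x , y , subst T (sym (in-rule a)) z

      receives⇐ : ∃ (λ u → Transfer r c u v) → ∃ L.Receives
      receives⇐ (u , x@((e , _) , _)) = port (~-sym e) ,
        receives⇐′ (port (~-sym e)) (subst (λ u → Transfer r c u v) (sym (nbr-port (~-sym e))) x)

    agrees-run : ∀ rs {c t} → (∀ v → Agrees rs c v (state t v)) →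
                 ∀ v → Agrees [] (run rs c) v (state (length rs + t) v)
    agrees-run []       ag = ag
    agrees-run (r ∷ rs) {c} {t} ag =
      subst (λ t → ∀ v → Agrees [] (run rs (exec r c)) v (state t v)) (+-suc (length rs) t)
            (agrees-run rs (agrees-step ag))

    scheduled-outputs : OutputsWithin (scheduled rs₀ s₀ f) G P ident (length rs₀)
                          λ v u → f (value (run rs₀ (start s₀)) v u)
    scheduled-outputs v = stopped _ (subst (λ t → Agrees [] (run rs₀ (start s₀)) v (state t v)) (+-identityʳ (length rs₀))
      (agrees-run rs₀ {t = 0} (λ _ → record { schedule≡ = refl ; ident≡ = refl ; status≡ = refl ; value≡ = λ _ → refl }) v))
      where
      stopped : ∀ s → Agrees [] (run rs₀ (start s₀)) v s →
                ∃[ o ] (Algorithm.output (scheduled rs₀ s₀ f) s ≡ just o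
                      × (∀ a → o a ≡ f (value (run rs₀ (start s₀)) v (nbr v a))))
      stopped (node _ _ _ x) ag with refl ← schedule≡ ag = f ∘ x , refl , λ a → cong f (value≡ ag a)

-- The rounds of the algorithm

open Status

before : Bool → ℕ → ℕ → Bool
before true  i j = i <ᵇ j
before false i j = j <ᵇ i

-- An orientation and the port numbers at the tail and at the head; with `true`, arcs go from the
-- smaller to the larger identifier.
Key : Set
Key = Bool × ℕ × ℕ

-- A node becomes marked if it is the first node of a path of its label class.
markRound : Key → Round
markRound (o , p , q) = record
  { outPort = p
  ; inPort  = q
  ; weight  = 0
  ; rule    = λ i s j t → live s ∧ live t ∧ before o i j
  ; next    = λ sends receives s → record s { mark = sends ∧ not receives }
  }

-- Runs directly after `markRound` with the same key. The head of a chosen arc has an arc coming in,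
-- so it is not marked itself; hence no node both sends and receives.
matchRound : ℕ → Key → Round
matchRound ρ (o , p , q) = record
  { outPort = p
  ; inPort  = q
  ; weight  = ρ
  ; rule    = λ i s j t → mark s ∧ live s ∧ live t ∧ before o i j
  ; next    = λ sends receives s → record s { live = live s ∧ not (sends ∨ receives) }
  }

-- Matches the white copy of the sender with the black copy of the receiver. An edge of the graph
-- gives two edges of the double cover, so its value may grow twice.
coverRound : ℕ → ℕ × ℕ → Round
coverRound ρ (p , q) = record
  { outPort = p
  ; inPort  = q
  ; weight  = ρ
  ; rule    = λ _ s _ t → white s ∧ black t
  ; next    = λ sends receives s → record s
                { white = white s ∧ not sends ; black = black s ∧ not receives }
  }

silentRound : (Status → Status) → Round
silentRound f = record
  { outPort = 0 ; inPort = 0 ; weight = 0 ; rule = λ _ _ _ _ → false ; next = λ _ _ → f }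

-- Splitting turns capacity `2 * ρ` into two copies of capacity `ρ`. Merging keeps a node live if
-- exactly one copy is left; with both left it retires, all its neighbours being saturated.
splitRound mergeRound : Round
splitRound = silentRound λ s → record s { white = live s ; black = live s }
mergeRound = silentRound λ s → record s { live = white s xor black s }

matchRounds : ℕ → List Key → List Round
matchRounds ρ []       = []
matchRounds ρ (k ∷ ks) = markRound k ∷ matchRound ρ k ∷ matchRounds ρ ks

labels : ℕ → List (ℕ × ℕ)
labels Δ = cartesianProduct (upTo Δ) (upTo Δ)

keys : ℕ → List Key
keys Δ = cartesianProduct (true ∷ false ∷ []) (labels Δ)

coverRounds : ℕ → List (ℕ × ℕ) → List Round
coverRounds ρ = map (coverRound ρ)

-- Phase `0` ends after matching, as no two live nodes are adjacent then. In phase `suc k`, matching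
-- spends the entire capacity `2 ^ suc k`, and each copy in the cover is worth half of it.
program : ℕ → ℕ → List Round
program Δ zero    = matchRounds 1 (keys Δ)
program Δ (suc k) = matchRounds (2 ^ suc k) (keys Δ) ++
  splitRound ∷ coverRounds (2 ^ k) (labels Δ) ++ mergeRound ∷ program Δ k

-- Residual capacity promised by a status.
liveCap coverCap : ℕ → Status → ℕ
liveCap  ρ s = ρ * 𝟙 (live s)
coverCap ρ s = ρ * (𝟙 (white s) + 𝟙 (black s))

-- Bits and the bookkeeping of capacity

T⇒≡true : ∀ {b} → T b → b ≡ true
T⇒≡true {true} _ = refl

¬T⇒≡false : ∀ {b} → ¬ T b → b ≡ false
¬T⇒≡false {true}  ¬t = contradiction _ ¬t
¬T⇒≡false {false} _  = refl

T-∧-not : ∀ {A : Set} {b} (a : Dec A) → T (b ∧ not (does a)) → T b × ¬ A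
T-∧-not {b = true} (no ¬a) _ = _ , ¬a

T-∧-not⁻¹ : ∀ {A : Set} {b} (a : Dec A) → T b → ¬ A → T (b ∧ not (does a))
T-∧-not⁻¹ {b = true} (yes a) _ ¬a = ¬a a
T-∧-not⁻¹ {b = true} (no _)  _ _  = _

𝟙-split : ∀ {A : Set} {b b′} (a : Dec A) → (A → 𝟙 b + 𝟙 b′ ≡ 1) →
          𝟙 (does a) ≡ 𝟙 (does a ∧ b) + 𝟙 (does a ∧ b′)
𝟙-split (no _)  _ = refl
𝟙-split (yes a) f = sym (f a)

-- The bit that is cleared pays for the unit that is transferred; a transfer happens only if the bit
-- is set.
spend : ∀ {A : Set} {b} (a : Dec A) → (A → T b) → 𝟙 (b ∧ not (does a)) + 𝟙 (does a) ≡ 𝟙 b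
spend {b = b}     (no _)  _   = trans (+-identityʳ _) (cong 𝟙 (∧-identityʳ b))
spend {b = true}  (yes _) _   = refl
spend {b = false} (yes a) a⇒b with () ← a⇒b a

spend-either : ∀ {A B : Set} {b} (x : Dec A) (y : Dec B) → (A → T b) → (B → T b) → (A → ¬ B) →
               𝟙 (b ∧ not (does x ∨ does y)) + (𝟙 (does x) + 𝟙 (does y)) ≡ 𝟙 b
spend-either (no _)          y       _ g _  = spend y g
spend-either x@(yes _)       (no _)  f _ _  = spend x f
spend-either (yes a)         (yes b) _ _ ex = contradiction b (ex a)

spend-both : ∀ {A B : Set} {b b′} (x : Dec A) (y : Dec B) → (A → T b) → (B → T b′) →
             (𝟙 (b ∧ not (does x)) + 𝟙 (b′ ∧ not (does y))) + (𝟙 (does x) + 𝟙 (does y)) ≡ 𝟙 b + 𝟙 b′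
spend-both {b = b} {b′} x y f g = trans
  (interchange (𝟙 (b ∧ not (does x))) (𝟙 (b′ ∧ not (does y))) (𝟙 (does x)) (𝟙 (does y)))
  (cong₂ _+_ (spend x f) (spend y g))

xor⇒ : ∀ a b → T (a xor b) → (T a × ¬ T b) ⊎ (¬ T a × T b)
xor⇒ true  false _ = inj₁ (_ , id)
xor⇒ false true  _ = inj₂ (id , _)

-- Correctness

module Correctness {n} (G : Graph n) (P : PortNumbering G) (ident : Fin n → ℕ) (B : ℕ) where
  open Graph G
  open PortNumbering P
  open Network G P ident

  -- Loads and residual capacities

  total : Config → Fin n → ℕ
  total c v = sum (value c v)

  moved : Round → Config → Fin n → ℕ
  moved r c v = Round.weight r * (𝟙 (does (sends? r c v)) + 𝟙 (does (receives? r c v)))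

  -- By `label-functional` at most one transfer leaves `v` and at most one enters it, so each sum of
  -- indicators over all nodes is 0 or 1.
  total-exec : ∀ r c v → total (exec r c) v ≡ total c v + moved r c v
  total-exec r c v = begin
    total (exec r c) v                                ≡⟨ ∑-distrib-+ (value c v) (λ u → w * (out u + in′ u)) ⟩
    total c v + sum (λ u → w * (out u + in′ u))       ≡⟨ cong (total c v +_) (sym (*-distribˡ-sum w (λ u → out u + in′ u))) ⟩
    total c v + w * sum (λ u → out u + in′ u)         ≡⟨ cong (λ x → total c v + w * x) (∑-distrib-+ out in′) ⟩
    total c v + w * (sum out + sum in′)               ≡⟨ cong (λ x → total c v + w * x) (cong₂ _+_
      (count-unique (transfer? r c v) λ (l , _) (l′ , _) → label-functional l l′)
      (count-unique (λ u → transfer? r c u v) λ (l , _) (l′ , _) → label-functional (label-sym l) (label-sym l′))) ⟩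
    total c v + moved r c v                           ∎
    where
    open ≡-Reasoning
    w = Round.weight r
    out in′ : Fin n → ℕ
    out u = 𝟙 (does (transfer? r c v u))
    in′ u = 𝟙 (does (transfer? r c u v))

  -- `total` sums over all nodes, the load over neighbours; `support` makes them agree.
  record Wellformed (c : Config) : Set where
    field
      symmetric : ∀ v u → value c v u ≡ value c u v
      support   : ∀ {v u} → ¬ v ~ u → value c v u ≡ 0
  open Wellformed

  exec-wellformed : ∀ r {c} → Wellformed c → Wellformed (exec r c)
  symmetric (exec-wellformed r {c} wf) v u =
    cong₂ (λ x y → x + Round.weight r * y) (symmetric wf v u)
      (+-comm (𝟙 (does (transfer? r c v u))) (𝟙 (does (transfer? r c u v))))
  support (exec-wellformed r {c} wf) {v} {u} v≁u = begin
    value c v u + w * (𝟙 (does (transfer? r c v u)) + 𝟙 (does (transfer? r c u v)))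
      ≡⟨ cong₂ (λ x y → x + w * y) (support wf v≁u) (cong₂ (λ a b → 𝟙 a + 𝟙 b)
           (dec-false (transfer? r c v u) λ ((e , _) , _) → v≁u e)
           (dec-false (transfer? r c u v) λ ((e , _) , _) → v≁u (~-sym e))) ⟩
    w * 0
      ≡⟨ *-zeroʳ w ⟩
    0 ∎
    where
    open ≡-Reasoning
    w = Round.weight r

  -- The second case is that of a node that has retired with positive residual
  -- capacity, since all its neighbours are saturated.
  Balanced : (Status → ℕ) → Config → Fin n → Set
  Balanced cap c v = total c v + cap (status c v) ≡ B
    ⊎ (cap (status c v) ≡ 0 × total c v ≤ B × (∀ {u} → v ~ u → total c u ≡ B))

  record Sound (cap : Status → ℕ) (c : Config) : Set where
    field
      wellformed : Wellformed c
      balanced   : ∀ v → Balanced cap c v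
  open Sound

  saturated⇒cap≡0 : ∀ cap c v → Balanced cap c v → total c v ≡ B → cap (status c v) ≡ 0
  saturated⇒cap≡0 cap c v (inj₁ tight) full =
    +-cancelˡ-≡ (total c v) _ 0 (trans tight (trans (sym full) (sym (+-identityʳ _))))
  saturated⇒cap≡0 cap c v (inj₂ (cap≡0 , _)) _ = cap≡0

  -- The load gained is the capacity lost. A retired node and its saturated neighbours have capacity
  -- 0, so their loads stay fixed. There are two capacity functions because splitting changes what a
  -- status promises.
  exec-sound : ∀ {cap cap′} r {c} → (∀ v → cap′ (status (exec r c) v) + moved r c v ≡ cap (status c v)) →
               Sound cap c → Sound cap′ (exec r c)
  wellformed (exec-sound r _ sound) = exec-wellformed r (wellformed sound)
  balanced (exec-sound {cap} {cap′} r {c} conserved sound) v with balanced sound v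
  ... | inj₁ tight = inj₁ (begin
    total (exec r c) v + cap′ (status (exec r c) v)       ≡⟨ cong (_+ cap′ (status (exec r c) v)) (total-exec r c v) ⟩
    total c v + moved r c v + cap′ (status (exec r c) v)  ≡⟨ +-assoc (total c v) _ _ ⟩
    total c v + (moved r c v + cap′ (status (exec r c) v)) ≡⟨ cong (total c v +_) (trans (+-comm (moved r c v) _) (conserved v)) ⟩
    total c v + cap (status c v)                          ≡⟨ tight ⟩
    B                                                     ∎)
    where open ≡-Reasoning
  ... | inj₂ (cap≡0 , ≤B , closed) = inj₂
    ( m+n≡0⇒m≡0 _ (trans (conserved v) cap≡0)
    , subst (_≤ B) (sym (unmoved cap≡0)) ≤B
    , λ {u} e → trans (unmoved (saturated⇒cap≡0 cap c u (balanced sound u) (closed e))) (closed e))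
    where
    unmoved : ∀ {u} → cap (status c u) ≡ 0 → total (exec r c) u ≡ total c u
    unmoved {u} cap≡0 = trans (total-exec r c u)
      (trans (cong (total c u +_) (m+n≡0⇒n≡0 (cap′ (status (exec r c) u)) (trans (conserved u) cap≡0))) (+-identityʳ _))

  Live White Black : Config → Fin n → Set
  Live  c v = T (live  (status c v))
  White c v = T (white (status c v))
  Black c v = T (black (status c v))

  LiveNeighbour : Config → Fin n → Fin n → Set
  LiveNeighbour c v u = v ~ u × Live c u

  liveNeighbour? : ∀ c v u → Dec (LiveNeighbour c v u)
  liveNeighbour? c v u = v ~? u ×-dec T? (live (status c u))

  degree : Config → Fin n → ℕ
  degree c v = count (liveNeighbour? c v)

  -- Matching the first nodes of paths

  Arc : Key → Config → Fin n → Fin n → Set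
  Arc (o , p , q) c v u = Label p q v u × Live c v × Live c u × T (before o (ident v) (ident u))

  arc-mono : ∀ k c c′ {v u} → (Live c v → Live c′ v) → (Live c u → Live c′ u) → Arc k c v u → Arc k c′ v u
  arc-mono k c c′ f g (l , lv , lu , b) = l , f lv , g lu , b

  mark⇒arc : ∀ k c {v u} → Transfer (markRound k) c v u → Arc k c v u
  mark⇒arc k c {v} (l , t) = let lv , t′ = to (T-∧ {live (status c v)}) t in l , lv , to T-∧ t′

  arc⇒mark : ∀ k c {v u} → Arc k c v u → Transfer (markRound k) c v u
  arc⇒mark k c {v} (l , lv , t) = l , from (T-∧ {live (status c v)}) (lv , from T-∧ t)

  module MatchStep (ρ : ℕ) (k : Key) (c : Config) where

    c₁ c₂ : Config
    c₁ = exec (markRound k) c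
    c₂ = exec (matchRound ρ k) c₁

    -- `markRound` leaves `live` as it is, so the rest of the rule reads as in `c`, and `mark`
    -- excludes an arc into the tail.
    match⇒ : ∀ {v u} → Transfer (matchRound ρ k) c₁ v u → Arc k c v u × ¬ (∃[ w ] Arc k c w v)
    match⇒ {v} (l , t) =
      let m , t′ = to (T-∧ {mark (status c₁ v)}) t
      in mark⇒arc k c (l , t′) , λ (w , arc) →
           proj₂ (T-∧-not {b = does (sends? (markRound k) c v)} (receives? (markRound k) c v) m)
                 (w , arc⇒mark k c arc)

    match⇐ : ∀ {v u} → Arc k c v u → ¬ (∃[ w ] Arc k c w v) → Transfer (matchRound ρ k) c₁ v u
    match⇐ {v} {u} arc ¬in =
      let l , t = arc⇒mark k c arc
      in l , from (T-∧ {mark (status c₁ v)}) (T-∧-not⁻¹ (receives? (markRound k) c v)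
               (subst T (sym (dec-true (sends? (markRound k) c v) (u , l , t))) _)
               (λ (w , arc) → ¬in (w , mark⇒arc k c arc)) , t)

    shrinks : ∀ v → Live c₂ v → Live c v
    shrinks v = proj₁ ∘ to (T-∧ {live (status c v)})

    -- Without an arc coming in, `v` would be the first node of its path, would be matched along its
    -- arc and would cease to be live.
    covered : ∀ {v} → Live c₂ v → ∃ (Arc k c v) → ∃[ w ] Arc k c w v
    covered {v} live₂ (u , arc) = decidable-stable
      (map′ (λ (w , t) → w , mark⇒arc k c t) (λ (w , a) → w , arc⇒mark k c a) (receives? (markRound k) c v))
      λ ¬in → ¬live (u , match⇐ arc ¬in)
      where
      ¬live : ¬ ∃ (Transfer (matchRound ρ k) c₁ v)
      ¬live s = proj₂
        (T-∧-not {b = live (status c v)} (sends? (matchRound ρ k) c₁ v ⊎-dec receives? (matchRound ρ k) c₁ v) live₂)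
        (inj₁ s)

    sound : Sound (liveCap ρ) c → Sound (liveCap ρ) c₂
    sound s = exec-sound (matchRound ρ k) conserved
      (exec-sound {cap′ = liveCap ρ} (markRound k) (λ v → +-identityʳ (liveCap ρ (status c v))) s)
      where
      conserved : ∀ v → liveCap ρ (status c₂ v) + moved (matchRound ρ k) c₁ v ≡ liveCap ρ (status c v)
      conserved v = trans (sym (*-distribˡ-+ ρ _ _)) (cong (ρ *_)
        (spend-either (sends? (matchRound ρ k) c₁ v) (receives? (matchRound ρ k) c₁ v)
          (λ (_ , t) → let (_ , lv , _) , _ = match⇒ t in lv)
          (λ (_ , t) → let (_ , _ , lv , _) , _ = match⇒ t in lv)
          -- If `v` both sent and received, the arc it receives along would contradict that it is
          -- the first node of its path.
          (λ (_ , t) (w , t′) → proj₂ (match⇒ t) (w , proj₁ (match⇒ t′)))))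

  -- `covered` assumes that `v` has kept all its live neighbours: then the arc into `v` found when
  -- key `k` was treated is still there at the end.
  record Matched (ρ : ℕ) (ks : List Key) (c c′ : Config) : Set where
    field
      shrinks : ∀ v → Live c′ v → Live c v
      covered : ∀ {k v} → k ∈ ks → Live c′ v → (∀ {u} → v ~ u → Live c u → Live c′ u) →
                ∃ (Arc k c′ v) → ∃[ w ] Arc k c′ w v
      sound   : Sound (liveCap ρ) c → Sound (liveCap ρ) c′

  matchRounds-matched : ∀ ρ ks c → Matched ρ ks c (run (matchRounds ρ ks) c)
  matchRounds-matched ρ []       c = record { shrinks = λ _ → id ; covered = λ () ; sound = id }
  matchRounds-matched ρ (k ∷ ks) c = record
    { shrinks = back
    ; covered = λ
        { (here refl) live′ kept (u , arc) →
            -- Liveness only shrinks, so an arc of `c′` is one of `c`; its counterpart into `v`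
            -- survives by `kept`.
            let w , arc′ = Step.covered (Rest.shrinks _ live′) (u , arc-mono k c′ c (back _) (back u) arc)
                (e , _) , lw , _ = arc′
            in w , arc-mono k c c′ (kept (~-sym e)) (λ _ → live′) arc′
        ; (there k∈ks) live′ kept → Rest.covered k∈ks live′ λ e l → kept e (Step.shrinks _ l)
        }
    ; sound   = Rest.sound ∘ Step.sound
    }
    where
    module Step = MatchStep ρ k c
    c′ = run (matchRounds ρ ks) Step.c₂
    module Rest = Matched (matchRounds-matched ρ ks Step.c₂)
    back : ∀ v → Live c′ v → Live c v
    back v = Step.shrinks v ∘ Rest.shrinks v

  -- Parity of the live degree

  module _ {Δ} (maxDegree : MaxDegree≤ Δ) where

    endPort<Δ : ∀ {v u} → v ~ u → endPort v u < Δ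
    endPort<Δ {v} e = subst (_< Δ) (sym (endPort-~ e)) (<-≤-trans (toℕ<n (port e)) (maxDegree v))

    endPorts∈labels : ∀ {v u} → v ~ u → (endPort v u , endPort u v) ∈ labels Δ
    endPorts∈labels e = ∈-cartesianProduct⁺ (∈-upTo⁺ (endPort<Δ e)) (∈-upTo⁺ (endPort<Δ (~-sym e)))

    endPorts∈keys : ∀ o {v u} → v ~ u → (o , endPort v u , endPort u v) ∈ keys Δ
    endPorts∈keys true  e = ∈-cartesianProduct⁺ {xs = true ∷ false ∷ []} (here refl) (endPorts∈labels e)
    endPorts∈keys false e = ∈-cartesianProduct⁺ {xs = true ∷ false ∷ []} (there (here refl)) (endPorts∈labels e)

    module _ (ident-injective : Injective _≡_ _≡_ ident) {ρ c c′} (matched : Matched ρ (keys Δ) c c′) where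
      open Matched matched

      Side : Bool → Fin n → Fin n → Set
      Side o v u = LiveNeighbour c′ v u × T (before o (ident v) (ident u))

      side? : ∀ o v u → Dec (Side o v u)
      side? o v u = liveNeighbour? c′ v u ×-dec T? (before o (ident v) (ident u))

      one-side : ∀ {v u} → v ~ u → 𝟙 (before true (ident v) (ident u)) + 𝟙 (before false (ident v) (ident u)) ≡ 1
      one-side {v} {u} e with <-cmp (ident v) (ident u)
      ... | tri≈ _ i≡j _   = contradiction e (~-irrefl (ident-injective i≡j))
      ... | tri< i<j _ i≯j = cong₂ (λ a b → 𝟙 a + 𝟙 b) (T⇒≡true (<⇒<ᵇ i<j)) (¬T⇒≡false (i≯j ∘ <ᵇ⇒< _ _))
      ... | tri> i≮j _ i>j = cong₂ (λ a b → 𝟙 a + 𝟙 b) (¬T⇒≡false (i≮j ∘ <ᵇ⇒< _ _)) (T⇒≡true (<⇒<ᵇ i>j))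

      degree-sides : ∀ v → degree c′ v ≡ count (side? true v) + count (side? false v)
      degree-sides v = trans (sum-cong-≗ split) (∑-distrib-+ (λ u → 𝟙 (does (side? true v u))) (λ u → 𝟙 (does (side? false v u))))
        where
        split : ∀ u → 𝟙 (does (liveNeighbour? c′ v u)) ≡ 𝟙 (does (side? true v u)) + 𝟙 (does (side? false v u))
        split u = 𝟙-split (liveNeighbour? c′ v u) λ (e , _) → one-side e

      -- A live edge with port numbers (p , q) as seen from v corresponds to one with
      -- port numbers (q , p) as seen from v, of the opposite orientation.
      sides-equal : ∀ {v} → Live c′ v → (∀ {u} → v ~ u → Live c u → Live c′ u) →
                    count (side? true v) ≡ count (side? false v)
      sides-equal {v} live′ kept = count-bijection (side? true v) (side? false v)
        (λ u w → endPort v u ≟ endPort w v ×-dec endPort u v ≟ endPort v w)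
        (λ {u} ((e , lu) , b) →
          let w , (e′ , x , y) , lw , _ , b′ = covered (endPorts∈keys true e) live′ kept (u , (e , refl , refl) , live′ , lu , b)
          in w , ((~-sym e′ , lw) , b′) , sym x , sym y)
        (λ {w} ((e , lw) , b) →
          let u , (e′ , x , y) , lu , _ , b′ = covered (endPorts∈keys false e) live′ kept (w , (e , refl , refl) , live′ , lw , b)
          in u , ((~-sym e′ , lu) , b′) , y , x)
        (λ ((e , _) , _) ((e′ , _) , _) (_ , r) (_ , r′) → endPort-injective e e′ (trans (sym r) r′))
        (λ ((e , _) , _) ((e′ , _) , _) (r , _) (r′ , _) → endPort-injective e e′ (trans r (sym r′)))

      -- If `v` loses a live neighbour, its degree drops. Otherwise the degree is even by
      -- `sides-equal`, and an even number that is at most `suc (2 * k)` is at most `2 * k`.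
      matched-degree : ∀ k {v} → Live c′ v → degree c v ≤ suc (2 * k) → degree c′ v ≤ 2 * k
      matched-degree k {v} live′ bound
        with any? (λ u → liveNeighbour? c v u ×-dec ¬? (T? (live (status c′ u))))
      ... | yes (u , near , dead) = ℕ.s≤s⁻¹ (<-≤-trans
        (count-mono-< (liveNeighbour? c′ v) (liveNeighbour? c v) (λ (e , l) → e , shrinks _ l) near (dead ∘ proj₂)) bound)
      ... | no none = subst (_≤ 2 * k) (sym even) (*-monoʳ-≤ 2 (≮⇒≥ λ k<h → <⇒≱ (doubled k<h) bound′))
        where
        h = count (side? false v)
        kept : ∀ {u} → v ~ u → Live c u → Live c′ u
        kept {u} e l = decidable-stable (T? _) λ dead → none (u , (e , l) , dead)
        even : degree c′ v ≡ 2 * h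
        even = trans (degree-sides v) (trans (cong (_+ h) (sides-equal live′ kept)) (cong (h +_) (sym (+-identityʳ h))))
        bound′ : 2 * h ≤ suc (2 * k)
        bound′ = subst (_≤ suc (2 * k)) even (≤-trans
          (count-mono (liveNeighbour? c′ v) (liveNeighbour? c v) (λ (e , l) → e , shrinks _ l)) bound)
        doubled : k < h → suc (2 * k) < 2 * h
        doubled k<h = ≤-trans (≤-reflexive (cong suc (sym (+-suc k (k + 0))))) (*-monoʳ-≤ 2 k<h)

  -- Maximal matching of the bipartite double cover

  module CoverStep (ρ p q : ℕ) (c : Config) where

    r : Round
    r = coverRound ρ (p , q)

    c₁ : Config
    c₁ = exec r c

    transfer⇒ : ∀ {v u} → Transfer r c v u → White c v × Black c u
    transfer⇒ {v} (_ , t) = to (T-∧ {white (status c v)}) t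

    white⇒ : ∀ v → White c₁ v → White c v × ¬ ∃ (Transfer r c v)
    white⇒ v = T-∧-not (sends? r c v)

    black⇒ : ∀ v → Black c₁ v → Black c v × ¬ (∃[ u ] Transfer r c u v)
    black⇒ v = T-∧-not (receives? r c v)

    -- Had both copies been left, the round of this very label would have matched them.
    exhausted : ∀ {v u} → Label p q v u → White c₁ v → ¬ Black c₁ u
    exhausted {v} {u} l white₁ black₁ =
      let w , ¬sends = white⇒ v white₁
      in ¬sends (u , l , from (T-∧ {white (status c v)}) (w , proj₁ (black⇒ u black₁)))

    white-partner : ∀ v → White c v → ¬ White c₁ v → ∃[ u ] (v ~ u × Black c u × ¬ Black c₁ u)
    white-partner v w ¬w₁ =
      let u , t = decidable-stable (sends? r c v) (¬w₁ ∘ T-∧-not⁻¹ (sends? r c v) w)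
          (e , _) , _ = t
      in u , e , proj₂ (transfer⇒ t) , λ b₁ → proj₂ (black⇒ u b₁) (v , t)

    black-partner : ∀ v → Black c v → ¬ Black c₁ v → ∃[ u ] (v ~ u × White c u × ¬ White c₁ u)
    black-partner v b ¬b₁ =
      let u , t = decidable-stable (receives? r c v) (¬b₁ ∘ T-∧-not⁻¹ (receives? r c v) b)
          (e , _) , _ = t
      in u , ~-sym e , proj₁ (transfer⇒ t) , λ w₁ → proj₂ (white⇒ u w₁) (v , t)

    sound : Sound (coverCap ρ) c → Sound (coverCap ρ) c₁
    sound = exec-sound r λ v → trans (sym (*-distribˡ-+ ρ _ _)) (cong (ρ *_)
      (spend-both (sends? r c v) (receives? r c v) (λ (_ , t) → proj₁ (transfer⇒ t)) (λ (_ , t) → proj₂ (transfer⇒ t))))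

  -- `exhausted` is maximality with respect to the labels in `ls`. No status records the matched
  -- pairs; the partner fields retain that a copy vanishes only together with one of the other
  -- colour at a neighbour.
  record Covered (ρ : ℕ) (ls : List (ℕ × ℕ)) (c c′ : Config) : Set where
    field
      white-shrinks : ∀ v → White c′ v → White c v
      black-shrinks : ∀ v → Black c′ v → Black c v
      exhausted     : ∀ {p q v u} → (p , q) ∈ ls → Label p q v u → White c′ v → ¬ Black c′ u
      white-partner : ∀ v → White c v → ¬ White c′ v → ∃[ u ] (v ~ u × Black c u × ¬ Black c′ u)
      black-partner : ∀ v → Black c v → ¬ Black c′ v → ∃[ u ] (v ~ u × White c u × ¬ White c′ u)
      sound         : Sound (coverCap ρ) c → Sound (coverCap ρ) c′

  coverRounds-covered : ∀ ρ ls c → Covered ρ ls c (run (coverRounds ρ ls) c)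
  coverRounds-covered ρ []             c = record
    { white-shrinks = λ _ → id
    ; black-shrinks = λ _ → id
    ; exhausted     = λ ()
    ; white-partner = λ _ w ¬w → contradiction w ¬w
    ; black-partner = λ _ b ¬b → contradiction b ¬b
    ; sound         = id
    }
  coverRounds-covered ρ ((p , q) ∷ ls) c = record
    { white-shrinks = λ v → proj₁ ∘ Step.white⇒ v ∘ Rest.white-shrinks v
    ; black-shrinks = λ v → proj₁ ∘ Step.black⇒ v ∘ Rest.black-shrinks v
    ; exhausted     = λ
        -- Copies never come back, so a pair left at the end was left after the round of its label.
        { (here refl)  l w′ b′ → Step.exhausted l (Rest.white-shrinks _ w′) (Rest.black-shrinks _ b′)
        ; (there l∈ls) l       → Rest.exhausted l∈ls l
        }
    ; white-partner = white-partner
    ; black-partner = black-partner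
    ; sound         = Rest.sound ∘ Step.sound
    }
    where
    module Step = CoverStep ρ p q c
    c′ = run (coverRounds ρ ls) Step.c₁
    module Rest = Covered (coverRounds-covered ρ ls Step.c₁)

    white-partner : ∀ v → White c v → ¬ White c′ v → ∃[ u ] (v ~ u × Black c u × ¬ Black c′ u)
    white-partner v w ¬w′ with T? (white (status Step.c₁ v))
    ... | yes w₁ = let u , e , b₁ , ¬b′ = Rest.white-partner v w₁ ¬w′ in u , e , proj₁ (Step.black⇒ u b₁) , ¬b′
    ... | no ¬w₁ = let u , e , b , ¬b₁ = Step.white-partner v w ¬w₁ in u , e , b , ¬b₁ ∘ Rest.black-shrinks u

    black-partner : ∀ v → Black c v → ¬ Black c′ v → ∃[ u ] (v ~ u × White c u × ¬ White c′ u)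
    black-partner v b ¬b′ with T? (black (status Step.c₁ v))
    ... | yes b₁ = let u , e , w₁ , ¬w′ = Rest.black-partner v b₁ ¬b′ in u , e , proj₁ (Step.white⇒ u w₁) , ¬w′
    ... | no ¬b₁ = let u , e , w , ¬w₁ = Step.black-partner v b ¬b₁ in u , e , w , ¬w₁ ∘ Rest.white-shrinks u

  -- Splitting and merging the copies

  split-sound : ∀ ρ {c} → Sound (liveCap (2 * ρ)) c → Sound (coverCap ρ) (exec splitRound c)
  split-sound ρ {c} = exec-sound {cap′ = coverCap ρ} splitRound λ v →
    trans (+-identityʳ _) (halves (𝟙 (live (status c v))))
    where
    halves : ∀ x → ρ * (x + x) ≡ 2 * ρ * x
    halves x = trans (cong (λ y → ρ * (x + y)) (sym (+-identityʳ x)))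
      (trans (sym (*-assoc ρ 2 x)) (cong (_* x) (*-comm ρ 2)))

  module _ (ρ : ℕ) .{{_ : NonZero ρ}} {c : Config}
           (exhausted : ∀ {v u} → v ~ u → White c v → ¬ Black c u) where

    merge-unmoved : ∀ v → total (exec mergeRound c) v ≡ total c v
    merge-unmoved v = trans (total-exec mergeRound c v) (+-identityʳ _)

    -- A node with both copies left may retire: by `exhausted` its neighbours have neither copy, so
    -- they are saturated. With at most one copy left, merging preserves the capacity.
    merge-balanced : (∀ v → Balanced (coverCap ρ) c v) → ∀ v → Balanced (liveCap ρ) (exec mergeRound c) v
    merge-balanced balanced v = go (white (status c v)) (black (status c v)) refl refl (balanced v)
      where
      colourless : ∀ {u} → coverCap ρ (status c u) ≡ 0 → liveCap ρ (status (exec mergeRound c) u) ≡ 0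
      colourless {u} eq with white (status c u) | black (status c u)
      ... | true  | true  = *-zeroʳ ρ
      ... | true  | false = eq
      ... | false | true  = eq
      ... | false | false = *-zeroʳ ρ

      keep : ∀ {w b} → white (status c v) ≡ w → black (status c v) ≡ b → 𝟙 (w xor b) ≡ 𝟙 w + 𝟙 b →
             total c v + coverCap ρ (status c v) ≡ B →
             total (exec mergeRound c) v + liveCap ρ (status (exec mergeRound c) v) ≡ B
      keep refl refl eq tight = trans (cong₂ (λ x y → x + ρ * y) (merge-unmoved v) eq) tight

      go : ∀ w b → white (status c v) ≡ w → black (status c v) ≡ b →
           Balanced (coverCap ρ) c v → Balanced (liveCap ρ) (exec mergeRound c) v
      go w b eqw eqb (inj₂ (cap≡0 , ≤B , closed)) = inj₂
        ( colourless {v} cap≡0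
        , subst (_≤ B) (sym (merge-unmoved v)) ≤B
        , λ {u} e → trans (merge-unmoved u) (closed e) )
      go true true eqw eqb (inj₁ tight) = inj₂
        ( trans (cong₂ (λ w b → ρ * 𝟙 (w xor b)) eqw eqb) (*-zeroʳ ρ)
        , subst (_≤ B) (sym (merge-unmoved v)) (m+n≤o⇒m≤o (total c v) (≤-reflexive tight))
        , closed )
        where
        White-v : White c v
        White-v = subst T (sym eqw) _
        Black-v : Black c v
        Black-v = subst T (sym eqb) _
        full-v : total c v ≡ B → ρ * 2 ≡ 0
        full-v full = trans (sym (cong₂ (λ w b → ρ * (𝟙 w + 𝟙 b)) eqw eqb)) (saturated⇒cap≡0 (coverCap ρ) c v (inj₁ tight) full)
        closed : ∀ {u} → v ~ u → total (exec mergeRound c) u ≡ B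
        closed {u} e with balanced u
        -- If `u` had retired, `v` would be saturated, contrary to its positive capacity `ρ * 2`.
        ... | inj₂ (_ , _ , closed-u) =
          contradiction (m*n≡0⇒m≡0 ρ 2 (full-v (closed-u (~-sym e)))) (ℕ.≢-nonZero⁻¹ ρ)
        ... | inj₁ tight-u = trans (merge-unmoved u) (begin
          total c u                             ≡⟨ sym (+-identityʳ _) ⟩
          total c u + 0                         ≡⟨ cong (total c u +_) (sym (*-zeroʳ ρ)) ⟩
          total c u + ρ * 0                     ≡⟨ cong₂ (λ w b → total c u + ρ * (𝟙 w + 𝟙 b))
                                                     (sym (¬T⇒≡false λ w → exhausted (~-sym e) w Black-v))
                                                     (sym (¬T⇒≡false (exhausted e White-v))) ⟩
          total c u + coverCap ρ (status c u)   ≡⟨ tight-u ⟩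
          B                                     ∎)
          where open ≡-Reasoning
      go true  false eqw eqb (inj₁ tight) = inj₁ (keep eqw eqb refl tight)
      go false true  eqw eqb (inj₁ tight) = inj₁ (keep eqw eqb refl tight)
      go false false eqw eqb (inj₁ tight) = inj₁ (keep eqw eqb refl tight)

    merge-sound : Sound (coverCap ρ) c → Sound (liveCap ρ) (exec mergeRound c)
    merge-sound sound = record
      { wellformed = exec-wellformed mergeRound (wellformed sound)
      ; balanced   = merge-balanced (balanced sound)
      }

  -- A maximal fractional matching in units of `1 / B`.
  record Saturating (c : Config) : Set where
    field
      wellformed : Wellformed c
      bounded    : ∀ v → total c v ≤ B
      saturated  : ∀ {v u} → v ~ u → total c v ≡ B ⊎ total c u ≡ B

  -- Progress made by a phase

  module Halving {Δ} (maxDegree : MaxDegree≤ Δ) (ρ : ℕ) (c : Config) where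

    c₁ c₂ c₃ : Config
    c₁ = exec splitRound c
    c₂ = run (coverRounds ρ (labels Δ)) c₁
    c₃ = exec mergeRound c₂

    open Covered (coverRounds-covered ρ (labels Δ) c₁)

    uncovered : ∀ {v u} → v ~ u → White c₂ v → ¬ Black c₂ u
    uncovered e = exhausted (endPorts∈labels maxDegree e) (e , refl , refl)

    one-colour : ∀ v → Live c₃ v → (White c₂ v × ¬ Black c₂ v) ⊎ (¬ White c₂ v × Black c₂ v)
    one-colour v = xor⇒ (white (status c₂ v)) (black (status c₂ v))

    colourless : ∀ u → ¬ White c₂ u → ¬ Black c₂ u → ¬ Live c₃ u
    colourless u ¬w ¬b l with one-colour u l
    ... | inj₁ (w , _) = ¬w w
    ... | inj₂ (_ , b) = ¬b b

    live₃⇒live : ∀ v → Live c₃ v → Live c v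
    live₃⇒live v l with one-colour v l
    ... | inj₁ (w , _) = white-shrinks v w
    ... | inj₂ (_ , b) = black-shrinks v b

    -- The copy of `v` that is gone was matched with a copy at some `u`. The other copy of `u` is
    -- gone too, since it could be matched with the copy left at `v`; so `u` has no copy.
    lost-neighbour : ∀ v → Live c₃ v → ∃[ u ] (LiveNeighbour c v u × ¬ Live c₃ u)
    lost-neighbour v l with one-colour v l
    ... | inj₁ (w , ¬b) =
      -- `White c₁ u` unfolds to `Live c u`, because splitting gives both copies to exactly the live
      -- nodes.
      let u , e , l , ¬w′ = black-partner v (white-shrinks v w) ¬b
      in u , (e , l) , colourless u ¬w′ (uncovered e w)
    ... | inj₂ (¬w , b) =
      let u , e , l , ¬b′ = white-partner v (black-shrinks v b) ¬w
      in u , (e , l) , colourless u (λ w → uncovered (~-sym e) w b) ¬b′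

    degree-decreases : ∀ v → Live c₃ v → degree c₃ v < degree c v
    degree-decreases v l = let _ , near , dead = lost-neighbour v l in
      count-mono-< (liveNeighbour? c₃ v) (liveNeighbour? c v) (λ (e , l) → e , live₃⇒live _ l) near (dead ∘ proj₂)

    halving-sound : .{{NonZero ρ}} → Sound (liveCap (2 * ρ)) c → Sound (liveCap ρ) c₃
    halving-sound s = merge-sound ρ uncovered (sound (split-sound ρ s))

  module _ {Δ} (maxDegree : MaxDegree≤ Δ) (ident-injective : Injective _≡_ _≡_ ident) where

    -- A retired endpoint has only saturated neighbours. Otherwise one endpoint is not live, as two
    -- live ones would be neighbours of each other, and its capacity is used up.
    isolated⇒saturating : ∀ ρ {c} → Sound (liveCap ρ) c → (∀ v → Live c v → degree c v ≤ 0) → Saturating c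
    isolated⇒saturating ρ {c} s isolated = record
      { wellformed = wellformed s
      ; bounded    = λ v → bounded (balanced s v)
      ; saturated  = λ {v} {u} e → saturated e (balanced s v) (balanced s u)
      }
      where
      bounded : ∀ {v} → Balanced (liveCap ρ) c v → total c v ≤ B
      bounded {v} (inj₁ tight)      = m+n≤o⇒m≤o (total c v) (≤-reflexive tight)
      bounded (inj₂ (_ , ≤B , _)) = ≤B

      dead⇒full : ∀ {v} → total c v + liveCap ρ (status c v) ≡ B → ¬ Live c v → total c v ≡ B
      dead⇒full {v} tight dead = begin
        total c v                            ≡⟨ sym (+-identityʳ _) ⟩
        total c v + 0                        ≡⟨ cong (total c v +_) (sym (*-zeroʳ ρ)) ⟩
        total c v + ρ * 0                    ≡⟨ cong (λ l → total c v + ρ * 𝟙 l) (sym (¬T⇒≡false dead)) ⟩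
        total c v + liveCap ρ (status c v)   ≡⟨ tight ⟩
        B                                    ∎
        where open ≡-Reasoning

      saturated : ∀ {v u} → v ~ u → Balanced (liveCap ρ) c v → Balanced (liveCap ρ) c u →
                  total c v ≡ B ⊎ total c u ≡ B
      saturated e (inj₂ (_ , _ , closed)) _ = inj₂ (closed e)
      saturated e (inj₁ _) (inj₂ (_ , _ , closed)) = inj₁ (closed (~-sym e))
      saturated {v} {u} e (inj₁ tight-v) (inj₁ tight-u) with T? (live (status c v))
      ... | no dead = inj₁ (dead⇒full tight-v dead)
      ... | yes l   = inj₂ (dead⇒full tight-u λ l′ → <⇒≱ (≤-trans
        (≤-reflexive (sym (cong 𝟙 (dec-true (liveNeighbour? c v u) (e , l′)))))
        (term≤sum (λ u → 𝟙 (does (liveNeighbour? c v u))) u)) (isolated v l))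

    -- The invariant of phase `k`. In phase `suc k` the degree bound falls from `2 * k + 3` to
    -- `2 * k + 2` by parity and to `2 * k + 1` by the lost neighbour, while the capacity halves.
    program-saturating : ∀ k {c} → Sound (liveCap (2 ^ k)) c → (∀ v → Live c v → degree c v ≤ suc (2 * k)) →
                         Saturating (run (program Δ k) c)
    program-saturating zero {c} s bound = isolated⇒saturating 1 (Matched.sound matched s) λ v l →
      matched-degree maxDegree ident-injective matched 0 l (bound v (Matched.shrinks matched v l))
      where
      matched = matchRounds-matched 1 (keys Δ) c
    program-saturating (suc k) {c} s bound = subst Saturating
      (sym (trans (run-++ (matchRounds (2 ^ suc k) (keys Δ))) (run-++ (coverRounds (2 ^ k) (labels Δ)))))
      (program-saturating k (halving-sound {{m^n≢0 2 k}} (Matched.sound matched s)) λ v l →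
        ℕ.s≤s⁻¹ (≤-trans (<-≤-trans (degree-decreases v l)
          (matched-degree maxDegree ident-injective matched (suc k) (live₃⇒live v l) (bound v (Matched.shrinks matched v (live₃⇒live v l)))))
          (≤-reflexive (cong suc (+-suc k (k + 0))))))
      where
      matched = matchRounds-matched (2 ^ suc k) (keys Δ) c
      open Halving maxDegree (2 ^ k) (run (matchRounds (2 ^ suc k) (keys Δ)) c)

-- Running time

length-cartesianProduct : ∀ {A B : Set} (xs : List A) (ys : List B) →
                          length (cartesianProduct xs ys) ≡ length xs * length ys
length-cartesianProduct []       ys = refl
length-cartesianProduct (x ∷ xs) ys = trans (length-++ (map (x ,_) ys))
  (cong₂ _+_ (length-map (x ,_) ys) (length-cartesianProduct xs ys))

length-labels : ∀ Δ → length (labels Δ) ≡ Δ * Δ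
length-labels Δ = trans (length-cartesianProduct (upTo Δ) (upTo Δ)) (cong₂ _*_ (length-upTo Δ) (length-upTo Δ))

length-keys : ∀ Δ → length (keys Δ) ≡ 2 * (Δ * Δ)
length-keys Δ = trans (length-cartesianProduct (true ∷ false ∷ []) (labels Δ)) (cong (2 *_) (length-labels Δ))

length-matchRounds : ∀ ρ ks → length (matchRounds ρ ks) ≡ 2 * length ks
length-matchRounds ρ []       = refl
length-matchRounds ρ (k ∷ ks) = trans (cong (λ l → suc (suc l)) (length-matchRounds ρ ks)) (sym (*-suc 2 (length ks)))

-- The `2 * (Δ * Δ)` keys take two rounds each. A phase with halving adds `Δ * Δ` cover rounds, one
-- round to split and one to merge.
length-program : ∀ Δ k → length (program Δ k) ≡ 4 * (Δ * Δ) + k * (5 * (Δ * Δ) + 2)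
length-program Δ zero = trans (trans (length-matchRounds 1 (keys Δ)) (cong (2 *_) (length-keys Δ)))
  (solve 1 (λ x → con 2 :* (con 2 :* x) := con 4 :* x :+ con 0) refl (Δ * Δ))
  where open +-*-Solver
length-program Δ (suc k) = begin
  length (matchRounds (2 ^ suc k) (keys Δ) ++ splitRound ∷ coverRounds (2 ^ k) (labels Δ) ++ mergeRound ∷ program Δ k)
    ≡⟨ length-++ (matchRounds (2 ^ suc k) (keys Δ)) ⟩
  length (matchRounds (2 ^ suc k) (keys Δ)) + suc (length (coverRounds (2 ^ k) (labels Δ) ++ mergeRound ∷ program Δ k))
    ≡⟨ cong₂ (λ a b → a + suc b)
         (trans (length-matchRounds (2 ^ suc k) (keys Δ)) (cong (2 *_) (length-keys Δ)))
         (trans (length-++ (coverRounds (2 ^ k) (labels Δ)))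
           (cong₂ (λ a b → a + suc b) (trans (length-map (coverRound (2 ^ k)) (labels Δ)) (length-labels Δ)) (length-program Δ k))) ⟩
  2 * (2 * D) + suc (D + suc (4 * D + k * (5 * D + 2)))
    ≡⟨ solve 2 (λ D k → con 2 :* (con 2 :* D) :+ (con 1 :+ (D :+ (con 1 :+ (con 4 :* D :+ k :* (con 5 :* D :+ con 2)))))
                     := con 4 :* D :+ (con 1 :+ k) :* (con 5 :* D :+ con 2)) refl D k ⟩
  4 * D + suc k * (5 * D + 2) ∎
  where
  open ≡-Reasoning
  open +-*-Solver
  D = Δ * Δ

length-program-≤ : ∀ d → let Δ = 2 * d + 1 in length (program Δ d) ≤ 5 * Δ ^ 3
length-program-≤ d = begin
  length (program Δ d)                                                     ≡⟨ length-program Δ d ⟩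
  4 * (Δ * Δ) + d * (5 * (Δ * Δ) + 2)                                      ≤⟨ m≤m+n _ _ ⟩
  4 * (Δ * Δ) + d * (5 * (Δ * Δ) + 2) + slack                              ≡⟨ identity ⟩
  5 * Δ ^ 3                                                                ∎
  where
  open ≤-Reasoning
  open +-*-Solver
  Δ = 2 * d + 1
  -- The exact difference of the two sides as a polynomial in `d`; no coefficient is negative.
  slack = 20 * (d * d * d) + 24 * (d * d) + 7 * d + 1
  identity : 4 * (Δ * Δ) + d * (5 * (Δ * Δ) + 2) + slack ≡ 5 * Δ ^ 3
  identity = solve 1 (λ d → let Δ = con 2 :* d :+ con 1 in
      con 4 :* (Δ :* Δ) :+ d :* (con 5 :* (Δ :* Δ) :+ con 2)
        :+ (con 20 :* (d :* d :* d) :+ con 24 :* (d :* d) :+ con 7 :* d :+ con 1)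
      := con 5 :* Δ :^ 3) refl d

-- Rational edge values

toℚᵘ-/ : ∀ b .{{_ : NonZero b}} a → toℚᵘ (pos a / b) ℚᵘ.≃ pos a ℚᵘ./ b
toℚᵘ-/ (suc b) a = ℚ.toℚᵘ-fromℚᵘ (mkℚᵘ (pos a) b)

/ᵘ-+ : ∀ b .{{_ : NonZero b}} a c → pos (a + c) ℚᵘ./ b ℚᵘ.≃ pos a ℚᵘ./ b ℚᵘ.+ pos c ℚᵘ./ b
/ᵘ-+ (suc b) a c = *≡* (trans (sym (ℤ.*-assoc (pos (a + c)) (pos (suc b)) (pos (suc b))))
  (cong (ℤ._* pos (suc b)) (ℤ.*-distribʳ-+ (pos (suc b)) (pos a) (pos c))))

b/ᵘb≃1 : ∀ b .{{_ : NonZero b}} → pos b ℚᵘ./ b ℚᵘ.≃ ℚᵘ.1ℚᵘ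
b/ᵘb≃1 (suc b) = *≡* (ℤ.*-comm (pos (suc b)) (pos 1))

module _ (b : ℕ) .{{_ : NonZero b}} where

  -- Normalisation hides the common denominator, so the identity is checked on unnormalised
  -- fractions by cross multiplication.
  /-+ : ∀ a c → pos (a + c) / b ≡ pos a / b ℚ.+ pos c / b
  /-+ a c = ℚ.toℚᵘ-injective (begin
    toℚᵘ (pos (a + c) / b)                    ≈⟨ toℚᵘ-/ b (a + c) ⟩
    pos (a + c) ℚᵘ./ b                        ≈⟨ /ᵘ-+ b a c ⟩
    pos a ℚᵘ./ b ℚᵘ.+ pos c ℚᵘ./ b              ≈⟨ ℚᵘ.+-cong (toℚᵘ-/ b a) (toℚᵘ-/ b c) ⟨
    toℚᵘ (pos a / b) ℚᵘ.+ toℚᵘ (pos c / b)      ≈⟨ ℚ.toℚᵘ-homo-+ (pos a / b) (pos c / b) ⟨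
    toℚᵘ (pos a / b ℚ.+ pos c / b)              ∎)
    where
    open import Relation.Binary.Reasoning.Setoid ℚᵘ.≃-setoid

  0≤/ : ∀ a → 0ℚ ℚ.≤ pos a / b
  0≤/ a = ℚ.nonNegative⁻¹ (pos a / b) {{ℚ.normalize-nonNeg a b}}

  b/b≡1 : pos b / b ≡ 1ℚ
  b/b≡1 = ℚ.toℚᵘ-injective (ℚᵘ.≃-trans (toℚᵘ-/ b b) (b/ᵘb≃1 b))

  /-≤1 : ∀ {a} → a ≤ b → pos a / b ℚ.≤ 1ℚ
  /-≤1 {a} a≤b with e , eq ← m≤n⇒∃[o]m+o≡n a≤b = subst (pos a / b ℚ.≤_)
    (trans (sym (/-+ a e)) (trans (cong (λ x → pos x / b) eq) b/b≡1))
    (subst (ℚ._≤ pos a / b ℚ.+ pos e / b) (ℚ.+-identityʳ (pos a / b)) (ℚ.+-monoʳ-≤ (pos a / b) (0≤/ e)))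

  -- The summands dropped by the filter are zero. For the induction, `allFin` is generalised to
  -- `tabulate h`.
  foldr-filter : ∀ {n m} {Q : Pred (Fin n) 0ℓ} (Q? : Decidable Q) (g : Fin n → ℕ) → (∀ {u} → ¬ Q u → g u ≡ 0) →
                 (h : Fin m → Fin n) →
                 foldr ℚ._+_ 0ℚ (map (λ u → pos (g u) / b) (filter Q? (tabulate h))) ≡ pos (sum (g ∘ h)) / b
  foldr-filter {m = zero}  Q? g supp h = sym (ℚ.0/n≡0 b)
  foldr-filter {m = suc m} Q? g supp h with Q? (h zero)
  ... | yes _ = trans (cong (pos (g (h zero)) / b ℚ.+_) (foldr-filter Q? g supp (h ∘ suc))) (sym (/-+ (g (h zero)) (sum (g ∘ h ∘ suc))))
  ... | no ¬q = trans (foldr-filter Q? g supp (h ∘ suc)) (cong (λ x → pos (x + sum (g ∘ h ∘ suc)) / b) (sym (supp ¬q)))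

length-filter-tabulate : ∀ {n m} {Q : Pred (Fin n) 0ℓ} (Q? : Decidable Q) (h : Fin m → Fin n) →
                         length (filter Q? (tabulate h)) ≡ count (Q? ∘ h)
length-filter-tabulate {m = zero}  Q? h = refl
length-filter-tabulate {m = suc m} Q? h with does (Q? (h zero))
... | true  = cong suc (length-filter-tabulate Q? (h ∘ suc))
... | false = length-filter-tabulate Q? (h ∘ suc)

-- From the final configuration to rational edge values

initial : Status
initial = record { mark = false ; live = true ; white = false ; black = false }

theorem1p1 : (d c : ℕ) → 1 ≤ c →
    let Δ = 2 * d + 1 in
    Σ[ A ∈ LocalAlgorithm ]
    (∀ {n} (G : Graph n) → Graph.MaxDegree≤ G Δ →
    (P : PortNumbering G) (ids : Identifiers c n) →
    ∃[ x ] (OutputsWithin A G P (Identifiers.id ids) (5 * Δ ^ 3) x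
    × IsMaximalFractionalMatching G x
    × HasEdgeValuesOver G (2 ^ d) {{m^n≢0 2 d}} x))
theorem1p1 d c _ = algorithm , λ {n} G maxDegree P ids →
  let open Solution G maxDegree P ids in
  x , outputsWithin-≤ algorithm G P (Identifiers.id ids) x (length-program-≤ d)
        (Network.scheduled-outputs G P (Identifiers.id ids) (program Δ d) initial fraction)
    , maximal , edge-values
  where
  Δ = 2 * d + 1
  B = 2 ^ d
  instance
    B≢0 : NonZero B
    B≢0 = m^n≢0 2 d

  fraction : ℕ → ℚ
  fraction a = pos a / B

  algorithm : LocalAlgorithm
  algorithm = scheduled (program Δ d) initial fraction

  module Solution {n} (G : Graph n) (maxDegree : Graph.MaxDegree≤ G Δ)
                  (P : PortNumbering G) (ids : Identifiers c n) where
    open Graph G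
    open Identifiers ids renaming (id to ident)
    open Network G P ident
    open Correctness G P ident B

    start-sound : Sound (liveCap B) (start initial)
    start-sound = record
      { wellformed = record { symmetric = λ _ _ → refl ; support = λ _ → refl }
      ; balanced   = λ v → inj₁ (trans (cong (_+ B * 1) (sum-zero {n} λ _ → refl)) (*-identityʳ B))
      }

    start-degree : ∀ v → degree (start initial) v ≤ suc (2 * d)
    start-degree v = ≤-trans
      -- All nodes are live at the start, so `degree` is the degree in the graph.
      (≤-reflexive (sum-cong-≗ λ u → 𝟙-cong (liveNeighbour? (start initial) v u) (v ~? u) (λ (e , _) → e) (_, _)))
      (≤-trans (≤-reflexive (sym (length-filter-tabulate (v ~?_) id)))
        (≤-trans (maxDegree v) (≤-reflexive (+-comm (2 * d) 1))))

    final : Config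
    final = run (program Δ d) (start initial)

    -- Phase `d` fits the start: its capacity `2 ^ d` is `B`, and its degree bound `suc (2 * d)` is
    -- `Δ`.
    open Saturating (program-saturating maxDegree id-inj d start-sound λ v _ → start-degree v)
    open Wellformed wellformed

    x : Fin n → Fin n → ℚ
    x v u = fraction (value final v u)

    load≡ : ∀ v → load G x v ≡ fraction (total final v)
    load≡ v = foldr-filter B (v ~?_) (value final v) support id

    value≤B : ∀ v u → value final v u ≤ B
    value≤B v u = ≤-trans (term≤sum (value final v) u) (bounded v)

    full : ∀ {v} → total final v ≡ B → load G x v ≡ 1ℚ
    full {v} eq = trans (load≡ v) (trans (cong fraction eq) (b/b≡1 B))

    edge-values : HasEdgeValuesOver G B x
    edge-values {u} {v} _ = value final u v , value≤B u v , refl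

    maximal : IsMaximalFractionalMatching G x
    maximal = record
      { isFractionalMatching = record
        { isEdgeFunction = λ {u} {v} _ → cong fraction (symmetric u v)
        ; nonNegative    = λ {u} {v} _ → 0≤/ B (value final u v)
        ; atMostOne      = λ {u} {v} _ → /-≤1 B (value≤B u v)
        ; load≤1         = λ v → subst (ℚ._≤ 1ℚ) (sym (load≡ v)) (/-≤1 B (bounded v))
        }
      ; saturated = map-⊎ full full ∘ saturated
      }
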